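{- Let $A$ be a finite alphabet, let $M$ and $N$ be finite monoids with $N\in\mathbf J$, and let $\phi:A^*\to M$ and $\psi:A^*\to N$ be homomorphisms, where $\phi$ maps onto $M$. Suppose $\mathbf V$ is a pseudovariety of finite monoids with $\mathbf J_1\subseteq\mathbf V$. If every base monoid of $\ker(\psi\circ\phi^{ -1})$ is in $\mathbf V$, then $M\in\mathbf V\mathbin{**}\mathbf J$.
   Context: A monoid $M$ divides a monoid $N$ if $M$ is a homomorphic image of a submonoid of $N$. A pseudovariety is a class of finite monoids closed under finite direct products and division. $\mathbf{J}$ is the pseudovariety of finite monoids $M$ such that $MsM=MtM$ implies $s=t$ for all $s,t\in M$. $\mathbf J_1$ is the pseudovariety of finite idempotent commutative monoids ($x^2=x$, $xy=yx$). Two-sided semidirect product: for a finite alphabet $A$ and a homomorphism $\psi:A^*\to N$ into a finite monoid, let $\Sigma=N\times A\times N$, regarded as a finite alphabet, and define $\tau_\psi:A^*\to\Sigma^*$ by $\tau_\psi(a_1\cdots a_m)=\sigma_1\cdots\sigma_m$, where $\sigma_i=(\psi(a_1\cdots a_{i-1}),a_i,\psi(a_{i+1}\cdots a_m))$ (empty products give $1$). For pseudovarieties $\mathbf V,\mathbf W$, a finite monoid $M$ belongs to $\mathbf V\mathbin{**}\mathbf W$ if and only if, for a surjective homomorphism $\phi:A^*\to M$ with $A$ a finite alphabet, there exist homomorphisms $\psi:A^*\to N$ with $N\in\mathbf W$ and $h:(N\times A\times N)^*\to K$ with $K\in\mathbf V$ such that for all $v,w\in A^*$, $\psi(v)=\psi(w)$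 and $h(\tau_\psi(v))=h(\tau_\psi(w))$ imply $\phi(v)=\phi(w)$. (This does not depend on the choice of $A$ and $\phi$.) Kernel category: given homomorphisms $\phi:A^*\to M$ (onto) and $\psi:A^*\to N$ into finite monoids, the category $\ker(\psi\circ\phi^{ -1})$ has as objects the pairs $(n_1,n_2)\in N\times N$. Arrows $(n_1,n_2)\to(n_1',n_2')$ are represented by words $u\in A^*$ with $n_1'=n_1\psi(u)$ and $\psi(u)n_2'=n_2$; two such words $u,u'$ represent the same arrow if $\phi(vuw)=\phi(vu'w)$ for all $v,w\in A^*$ with $\psi(v)=n_1$ and $\psi(w)=n_2'$. Composition is induced by concatenation of words. The base monoid $M_{n_1,n_2}$ is the monoid of all arrows from $(n_1,n_2)$ to itself. -}

module Defs where

open import Algebra.Bundles using (Monoid)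
import Algebra.Construct.DirectProduct as DirectProduct
import Algebra.Construct.Terminal as Terminal
open import Algebra.Definitions using (Idempotent; Commutative)
open import Algebra.Morphism.Bundles using (MonoidHomomorphism)
open import Algebra.Morphism.Structures using (IsMonoidMonomorphism)
open import Data.Fin using (Fin)
open import Data.List using (List; []; _∷_; _++_; _∷ʳ_)
open import Data.List.Properties using (++-assoc; ++-identityʳ)
import Data.List.Relation.Binary.Equality.Setoid as ListEquality
open import Data.Product using (∃₂; Σ-syntax; ∃-syntax; _×_; _,_)
open import Data.Product.Relation.Binary.Pointwise.NonDependent using (_×ₛ_)
open import Function.Bundles using (Inverse)
open import Function.Definitions using (Surjective)
open import Level using (Level; 0ℓ; suc; _⊔_)
open import Relation.Binary.Bundles using (Setoid)
open import Relation.Binary.PropositionalEquality as ≡ using (_≡_; cong)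
import Relation.Binary.Reasoning.Setoid as SetoidReasoning
open import Relation.Unary using (Pred; _∈_; _⊆_; _≐_)

private
  variable
    p q : Level

-- Equality in alphabets and monoids is setoid equality throughout, since
-- arrows of the kernel category are words modulo a congruence.

Finite : Setoid 0ℓ 0ℓ → Set
Finite S = ∃[ n ] Inverse S (≡.setoid (Fin n))

FiniteMonoid : Pred (Monoid 0ℓ 0ℓ) 0ℓ
FiniteMonoid M = Finite (Monoid.setoid M)

Hom : Monoid 0ℓ 0ℓ → Monoid 0ℓ 0ℓ → Set
Hom M N = MonoidHomomorphism (Monoid.rawMonoid M) (Monoid.rawMonoid N)

Onto : ∀ M N → Hom M N → Set
Onto M N f = Surjective (Monoid._≈_ M) (Monoid._≈_ N) ⟦_⟧
  where open MonoidHomomorphism f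

_* : Setoid 0ℓ 0ℓ → Monoid 0ℓ 0ℓ
A * = record
  { Carrier  = List (Setoid.Carrier A)
  ; _≈_      = _≋_
  ; _∙_      = _++_
  ; ε        = []
  ; isMonoid = record
    { isSemigroup = record
      { isMagma = record
        { isEquivalence = ≋-isEquivalence
        ; ∙-cong        = ++⁺
        }
      ; assoc = λ u v w → ≋-reflexive (++-assoc u v w)
      }
    ; identity = (λ u → ≋-refl) , (λ u → ≋-reflexive (++-identityʳ u))
    }
  }
  where open ListEquality A

infix 20 _*

-- A submonoid of N is presented as a monoid S with an injective
-- homomorphism into N.
_Divides_ : Monoid 0ℓ 0ℓ → Monoid 0ℓ 0ℓ → Set₁
M Divides N =
  Σ[ S ∈ Monoid 0ℓ 0ℓ ]
    (∃[ i ] IsMonoidMonomorphism (Monoid.rawMonoid S) (Monoid.rawMonoid N) i)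
    × (Σ[ f ∈ Hom S M ] Onto S M f)

-- A class of finite monoids is a predicate on monoids all of whose members
-- are finite.
record IsPseudovariety (V : Pred (Monoid 0ℓ 0ℓ) p) : Set (suc 0ℓ ⊔ p) where
  field
    finite   : V ⊆ FiniteMonoid
    trivial  : Terminal.monoid ∈ V
    product  : ∀ {M N} → M ∈ V → N ∈ V → DirectProduct.monoid M N ∈ V
    division : ∀ {M N} → FiniteMonoid M → M Divides N → N ∈ V → M ∈ V

module _ (M : Monoid 0ℓ 0ℓ) where
  open Monoid M

  TwoSidedIdeal : Carrier → Pred Carrier 0ℓ
  TwoSidedIdeal s x = ∃₂ λ a b → x ≈ a ∙ s ∙ b

𝐉 : Pred (Monoid 0ℓ 0ℓ) 0ℓ
𝐉 M = FiniteMonoid M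
    × (∀ s t → TwoSidedIdeal M s ≐ TwoSidedIdeal M t → s ≈ t)
  where open Monoid M

𝐉₁ : Pred (Monoid 0ℓ 0ℓ) 0ℓ
𝐉₁ M = FiniteMonoid M × Idempotent _≈_ _∙_ × Commutative _≈_ _∙_
  where open Monoid M

ContextAlphabet : Setoid 0ℓ 0ℓ → Monoid 0ℓ 0ℓ → Setoid 0ℓ 0ℓ
ContextAlphabet A N = Monoid.setoid N ×ₛ (A ×ₛ Monoid.setoid N)

module _ (A : Setoid 0ℓ 0ℓ) (N : Monoid 0ℓ 0ℓ) (ψ : Hom (A *) N) where
  open Setoid A using () renaming (Carrier to Letter)
  open MonoidHomomorphism ψ

  -- The letters of the second argument, each with its left and right context
  -- inside the concatenation of the two arguments.
  τ-after : List Letter → List Letter → List (Setoid.Carrier (ContextAlphabet A N))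
  τ-after u []      = []
  τ-after u (a ∷ w) = (⟦ u ⟧ , a , ⟦ w ⟧) ∷ τ-after (u ∷ʳ a) w

  τ : List Letter → List (Setoid.Carrier (ContextAlphabet A N))
  τ = τ-after []

-- The condition on M is independent of the choice of alphabet A and of
-- surjection φ; membership asks for it at some such choice.
_**_ : Pred (Monoid 0ℓ 0ℓ) p → Pred (Monoid 0ℓ 0ℓ) q →
       Pred (Monoid 0ℓ 0ℓ) (suc 0ℓ ⊔ p ⊔ q)
(V ** W) M =
  FiniteMonoid M ×
  Σ[ A ∈ Setoid 0ℓ 0ℓ ] Finite A ×
  Σ[ φ ∈ Hom (A *) M ] Onto (A *) M φ ×
  Σ[ N ∈ Monoid 0ℓ 0ℓ ] N ∈ W ×
  Σ[ ψ ∈ Hom (A *) N ]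
  Σ[ K ∈ Monoid 0ℓ 0ℓ ] K ∈ V ×
  Σ[ h ∈ Hom (ContextAlphabet A N *) K ]
    let module M = Monoid M
        module N = Monoid N
        module K = Monoid K
        module φ = MonoidHomomorphism φ
        module ψ = MonoidHomomorphism ψ
        module h = MonoidHomomorphism h
    in ∀ v w → ψ.⟦ v ⟧ N.≈ ψ.⟦ w ⟧
             → h.⟦ τ A N ψ v ⟧ K.≈ h.⟦ τ A N ψ w ⟧
             → φ.⟦ v ⟧ M.≈ φ.⟦ w ⟧

record Category : Set₁ where
  infixr 7 _⨾_
  field
    Obj    : Set
    Arrows : Obj → Obj → Setoid 0ℓ 0ℓ

  _⇒_ : Obj → Obj → Set
  x ⇒ y = Setoid.Carrier (Arrows x y)

  _≈_ : ∀ {x y} → x ⇒ y → x ⇒ y → Set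
  _≈_ {x} {y} = Setoid._≈_ (Arrows x y)

  infix 4 _⇒_ _≈_

  field
    identity  : ∀ x → x ⇒ x
    _⨾_       : ∀ {x y z} → x ⇒ y → y ⇒ z → x ⇒ z
    ⨾-cong    : ∀ {x y z} {f f′ : x ⇒ y} {g g′ : y ⇒ z} →
                f ≈ f′ → g ≈ g′ → f ⨾ g ≈ f′ ⨾ g′
    assoc     : ∀ {w x y z} (f : w ⇒ x) (g : x ⇒ y) (h : y ⇒ z) →
                (f ⨾ g) ⨾ h ≈ f ⨾ (g ⨾ h)
    identityˡ : ∀ {x y} (f : x ⇒ y) → identity x ⨾ f ≈ f
    identityʳ : ∀ {x y} (f : x ⇒ y) → f ⨾ identity y ≈ f

  baseMonoid : Obj → Monoid 0ℓ 0ℓ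
  baseMonoid x = record
    { Carrier  = x ⇒ x
    ; _≈_      = _≈_
    ; _∙_      = _⨾_
    ; ε        = identity x
    ; isMonoid = record
      { isSemigroup = record
        { isMagma = record
          { isEquivalence = Setoid.isEquivalence (Arrows x x)
          ; ∙-cong        = ⨾-cong
          }
        ; assoc = assoc
        }
      ; identity = identityˡ , identityʳ
      }
    }

module _ (A : Setoid 0ℓ 0ℓ) (M N : Monoid 0ℓ 0ℓ)
         (φ : Hom (A *) M) (ψ : Hom (A *) N) where
  private
    module M = Monoid M
    module N = Monoid N
    module φ = MonoidHomomorphism φ
    module ψ = MonoidHomomorphism ψ

    Word : Set
    Word = List (Setoid.Carrier A)

    KObj : Set
    KObj = N.Carrier × N.Carrier

  record KernelArrow (x y : KObj) : Set where
    constructor arrow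
    private
      n₁  = let (n , _) = x in n
      n₂  = let (_ , n) = x in n
      n₁′ = let (n , _) = y in n
      n₂′ = let (_ , n) = y in n
    field
      word  : Word
      left  : n₁′ N.≈ n₁ N.∙ ψ.⟦ word ⟧
      right : ψ.⟦ word ⟧ N.∙ n₂′ N.≈ n₂

  open KernelArrow

  SameArrow : ∀ {x y} → KernelArrow x y → KernelArrow x y → Set
  SameArrow {n₁ , _} {_ , n₂′} f g =
    ∀ v w → ψ.⟦ v ⟧ N.≈ n₁ → ψ.⟦ w ⟧ N.≈ n₂′ →
    φ.⟦ v ++ word f ++ w ⟧ M.≈ φ.⟦ v ++ word g ++ w ⟧

  private
    φ-≡ : ∀ {u v} → u ≡ v → φ.⟦ u ⟧ M.≈ φ.⟦ v ⟧
    φ-≡ ≡.refl = M.refl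

    id : ∀ x → KernelArrow x x
    id (n₁ , n₂) = arrow []
      (N.sym (N.trans (N.∙-congˡ ψ.ε-homo) (N.identityʳ n₁)))
      (N.trans (N.∙-congʳ ψ.ε-homo) (N.identityˡ n₂))

    compose : ∀ {x y z} → KernelArrow x y → KernelArrow y z → KernelArrow x z
    compose {n₁ , n₂} {n₁′ , n₂′} {n₁″ , n₂″} (arrow u l r) (arrow u′ l′ r′) =
      arrow (u ++ u′)
        (begin
          n₁″                              ≈⟨ l′ ⟩
          n₁′ N.∙ ψ.⟦ u′ ⟧                 ≈⟨ N.∙-congʳ l ⟩
          (n₁ N.∙ ψ.⟦ u ⟧) N.∙ ψ.⟦ u′ ⟧    ≈⟨ N.assoc _ _ _ ⟩
          n₁ N.∙ (ψ.⟦ u ⟧ N.∙ ψ.⟦ u′ ⟧)    ≈⟨ N.∙-congˡ (ψ.homo u u′) ⟨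
          n₁ N.∙ ψ.⟦ u ++ u′ ⟧             ∎)
        (begin
          ψ.⟦ u ++ u′ ⟧ N.∙ n₂″            ≈⟨ N.∙-congʳ (ψ.homo u u′) ⟩
          (ψ.⟦ u ⟧ N.∙ ψ.⟦ u′ ⟧) N.∙ n₂″   ≈⟨ N.assoc _ _ _ ⟩
          ψ.⟦ u ⟧ N.∙ (ψ.⟦ u′ ⟧ N.∙ n₂″)   ≈⟨ N.∙-congˡ r′ ⟩
          ψ.⟦ u ⟧ N.∙ n₂′                  ≈⟨ r ⟩
          n₂                               ∎)
      where open SetoidReasoning N.setoid

    compose-cong : ∀ {x y z} {f f′ : KernelArrow x y} {g g′ : KernelArrow y z} →
                   SameArrow f f′ → SameArrow g g′ →
                   SameArrow (compose f g) (compose f′ g′)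
    compose-cong {f = f} {f′} {g} {g′} f≈f′ g≈g′ v w ψv ψw = begin
      φ.⟦ v ++ (word f ++ word g) ++ w ⟧
        ≈⟨ φ-≡ (cong (v ++_) (++-assoc (word f) (word g) w)) ⟩
      φ.⟦ v ++ word f ++ (word g ++ w) ⟧
        ≈⟨ f≈f′ v (word g ++ w) ψv
             (N.trans (ψ.homo (word g) w)
             (N.trans (N.∙-congˡ ψw) (right g))) ⟩
      φ.⟦ v ++ word f′ ++ (word g ++ w) ⟧
        ≈⟨ φ-≡ (++-assoc v (word f′) (word g ++ w)) ⟨
      φ.⟦ (v ++ word f′) ++ word g ++ w ⟧
        ≈⟨ g≈g′ (v ++ word f′) w
             (N.trans (ψ.homo v (word f′))
             (N.trans (N.∙-congʳ ψv) (N.sym (left f′)))) ψw ⟩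
      φ.⟦ (v ++ word f′) ++ word g′ ++ w ⟧
        ≈⟨ φ-≡ (++-assoc v (word f′) (word g′ ++ w)) ⟩
      φ.⟦ v ++ word f′ ++ (word g′ ++ w) ⟧
        ≈⟨ φ-≡ (cong (v ++_) (++-assoc (word f′) (word g′) w)) ⟨
      φ.⟦ v ++ (word f′ ++ word g′) ++ w ⟧ ∎
      where open SetoidReasoning M.setoid

    sameWord : ∀ {x y} {f g : KernelArrow x y} → word f ≡ word g → SameArrow f g
    sameWord eq v w _ _ = φ-≡ (cong (λ u → v ++ u ++ w) eq)

  ker : Category
  ker = record
    { Obj       = KObj
    ; Arrows    = λ x y → record
      { Carrier       = KernelArrow x y
      ; _≈_           = SameArrow
      ; isEquivalence = record
        { refl  = λ _ _ _ _ → M.refl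
        ; sym   = λ f≈g v w ψv ψw → M.sym (f≈g v w ψv ψw)
        ; trans = λ f≈g g≈h v w ψv ψw → M.trans (f≈g v w ψv ψw) (g≈h v w ψv ψw)
        }
      }
    ; identity  = id
    ; _⨾_       = compose
    ; ⨾-cong    = λ {_} {_} {_} {f} {f′} {g} {g′} →
                    compose-cong {f = f} {f′} {g} {g′}
    ; assoc     = λ f g h → sameWord {f = compose (compose f g) h}
                                     {compose f (compose g h)}
                                     (++-assoc (word f) (word g) (word h))
    ; identityˡ = λ f → sameWord {f = compose (id _) f} {f} ≡.refl
    ; identityʳ = λ f → sameWord {f = compose f (id _)} {f} (++-identityʳ (word f))
    }

{-# OPTIONS --safe #-}

-- Since N is J-trivial, the objects of the kernel category are partially
-- ordered by reachability, so a path that leaves an object never returns to it.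
-- Hence each word is a path made of loops and of transitions between distinct
-- objects, and the set of its transitions already determines their order.  A
-- letter of τ v records source, target and label of one step of the path.  So
-- the set of letters of τ v (a product of two-element semilattices) together
-- with the product of the loops at each object (a product of base monoids)
-- determines the arrow of v, and the given ψ itself serves as the J-part.

module Submission where

open import Defs
open import Algebra.Bundles using (Monoid; CommutativeMonoid)
import Algebra.Construct.DirectProduct as DirectProduct
import Algebra.Construct.Terminal as Terminal
open import Algebra.Morphism.Bundles using (MonoidHomomorphism)
open import Data.Bool using (_∨_)
open import Data.Bool.Properties using (∨-assoc; ∨-comm; ∨-idem; ∨-commutativeMonoid)
open import Data.Fin using (Fin; zero; suc)
open import Data.Fin.Properties as Fin using (2↔Bool; *↔×)
open import Data.List using (List; []; _∷_; _++_; _∷ʳ_; [_]; map; filter)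
open import Data.List.Properties
  using (∷ʳ-++; ++-assoc; ++-identityʳ; map-++; filter-++; filter-all; filter-none;
         filter-reject; filter-≐)
import Data.List.Membership.Setoid as Membership
open import Data.List.Membership.Setoid.Properties using (∈-resp-≈; ∈-resp-≋)
import Data.List.Relation.Binary.Equality.Setoid as ListEquality
open import Data.List.Relation.Unary.All as All using (All; []; _∷_)
open import Data.List.Relation.Unary.All.Properties using (all-filter; ∷ʳ⁺)
open import Data.List.Relation.Unary.Any using (here; there; any?)
open import Data.List.Relation.Unary.Any.Properties using (++⁻)
open import Data.Nat using (zero; suc)
open import Data.Product using (∃; Σ-syntax; _×_; _,_; proj₁; proj₂)
open import Data.Product.Function.NonDependent.Setoid using (_×-inverse_)
open import Data.Product.Relation.Binary.Pointwise.NonDependent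
  using (_×ₛ_; Pointwise-≡↔≡)
open import Data.Sum using (inj₁; inj₂)
open import Function.Bundles using (Inverse; mk⇔)
import Function.Construct.Composition as Compose
import Function.Construct.Symmetry as Symmetry
open import Function.Properties.Inverse using (Inverse⇒Injection)
open import Level as Level using (Level; 0ℓ; _⊔_)
open import Relation.Binary.Bundles using (Setoid)
open import Relation.Binary.Definitions using (Decidable)
open import Relation.Binary.PropositionalEquality as ≡ using (_≡_)
import Relation.Binary.Reasoning.Setoid as SetoidReasoning
open import Relation.Nullary using (¬_; Dec; yes; no; does; contradiction)
open import Relation.Nullary.Decidable using (_×-dec_; dec-true; does-⇔; via-injection)
open import Relation.Unary using (Pred; _∈_; _⊆_)

-- Finite setoids and the two-element semilattice.

finite⇒decidable : ∀ {S} → Finite S → Decidable (Setoid._≈_ S)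
finite⇒decidable (_ , S↔) = via-injection (Inverse⇒Injection S↔) Fin._≟_

×-finite : ∀ {S T} → Finite S → Finite T → Finite (S ×ₛ T)
×-finite (_ , S↔) (_ , T↔) =
  _ , Compose.inverse (S↔ ×-inverse T↔)
        (Compose.inverse Pointwise-≡↔≡ (Symmetry.inverse *↔×))

∨-monoid : Monoid 0ℓ 0ℓ
∨-monoid = CommutativeMonoid.monoid ∨-commutativeMonoid

∨-∈-𝐉₁ : ∨-monoid ∈ 𝐉₁
∨-∈-𝐉₁ = (2 , Symmetry.inverse 2↔Bool) , ∨-idem , ∨-comm

-- Occurrence of a letter as a homomorphism into the two-element semilattice.

module Containment (S : Setoid 0ℓ 0ℓ) (_≟_ : Decidable (Setoid._≈_ S)) where
  open Setoid S
  open Membership S using () renaming (_∈_ to _∈ₗ_)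

  contains? : ∀ σ s → Dec (σ ∈ₗ s)
  contains? σ = any? (σ ≟_)

  contains-++ : ∀ σ s t →
    does (contains? σ (s ++ t)) ≡ does (contains? σ s) ∨ does (contains? σ t)
  contains-++ σ []      t = ≡.refl
  contains-++ σ (ρ ∷ s) t = ≡.trans
    (≡.cong (does (σ ≟ ρ) ∨_) (contains-++ σ s t))
    (≡.sym (∨-assoc (does (σ ≟ ρ)) _ _))

  contains : Carrier → Hom (S *) ∨-monoid
  contains σ = record
    { ⟦_⟧ = λ s → does (contains? σ s)
    ; isMonoidHomomorphism = record
      { isMagmaHomomorphism = record
        { isRelHomomorphism = record
          { cong = λ {s} {t} s≋t → does-⇔
              (mk⇔ (∈-resp-≋ S s≋t) (∈-resp-≋ S (≋-sym s≋t)))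
              (contains? σ s) (contains? σ t)
          }
        ; homo = contains-++ σ
        }
      ; ε-homo = ≡.refl
      }
    }
    where open ListEquality S using (≋-sym)

  -- This inclusion is later applied to the transitions of one path, to find them in the other.
  contains-≡⇒⊆ : ∀ σ s t → does (contains? σ s) ≡ does (contains? σ t) →
                 σ ∈ₗ s → σ ∈ₗ t
  contains-≡⇒⊆ σ s t eq σ∈s with contains? σ t
  ... | yes σ∈t = σ∈t
  ... | no  _   = contradiction (≡.trans (≡.sym (dec-true (contains? σ s) σ∈s)) eq) λ ()

-- Relations on words implied by a homomorphism into a member of `V`.

module Recognition {p : Level} (V : Pred (Monoid 0ℓ 0ℓ) p) (pv : IsPseudovariety V)
                   (S : Setoid 0ℓ 0ℓ) where
  open IsPseudovariety pv

  private
    Word : Set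
    Word = List (Setoid.Carrier S)

  -- Stated as an implication, so that `R` may be a non-symmetric relation such as inclusion of
  -- letter sets.
  Determines : (Word → Word → Set) → Set (Level.suc 0ℓ ⊔ p)
  Determines R =
    Σ[ K ∈ Monoid 0ℓ 0ℓ ] K ∈ V ×
    Σ[ h ∈ Hom (S *) K ]
      (∀ s t → Monoid._≈_ K (MonoidHomomorphism.⟦_⟧ h s) (MonoidHomomorphism.⟦_⟧ h t) → R s t)

  _∧ᵈ_ : ∀ {R Q : Word → Word → Set} → Determines R → Determines Q →
         Determines (λ s t → R s t × Q s t)
  (K , K∈V , h , h⇒R) ∧ᵈ (L , L∈V , g , g⇒Q) =
    DirectProduct.monoid K L , product K∈V L∈V ,
    record
      { ⟦_⟧ = λ s → h.⟦ s ⟧ , g.⟦ s ⟧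
      ; isMonoidHomomorphism = record
        { isMagmaHomomorphism = record
          { isRelHomomorphism = record { cong = λ s≋t → h.⟦⟧-cong s≋t , g.⟦⟧-cong s≋t }
          ; homo = λ s t → h.homo s t , g.homo s t
          }
        ; ε-homo = h.ε-homo , g.ε-homo
        }
      } ,
    λ s t (h≈ , g≈) → h⇒R s t h≈ , g⇒Q s t g≈
    where
    module h = MonoidHomomorphism h
    module g = MonoidHomomorphism g

  ⋀-Fin : ∀ n {R : Fin n → Word → Word → Set} →
          (∀ i → Determines (R i)) → Determines (λ s t → ∀ i → R i s t)
  -- The empty conjunction is carried by the trivial monoid.
  ⋀-Fin zero    d = Terminal.monoid , trivial , record { isMonoidHomomorphism = _ } , λ _ _ _ ()
  ⋀-Fin (suc n) d =
    let K , K∈V , h , h⇒ = d zero ∧ᵈ ⋀-Fin n (λ i → d (suc i)) in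
    K , K∈V , h , λ s t eq → λ
      { zero    → proj₁ (h⇒ s t eq)
      ; (suc i) → proj₂ (h⇒ s t eq) i
      }

  -- The enumeration reaches only the representatives `from i`, and `x` equals `from (to x)` just up
  -- to the setoid equality; `resp` bridges this gap.
  ⋀ : ∀ {I} → Finite I → {R : Setoid.Carrier I → Word → Word → Set} →
      (∀ {x y s t} → Setoid._≈_ I x y → R x s t → R y s t) →
      (∀ x → Determines (R x)) → Determines (λ s t → ∀ x → R x s t)
  ⋀ (n , I↔) resp d =
    let K , K∈V , h , h⇒ = ⋀-Fin n (λ i → d (from i)) in
    K , K∈V , h , λ s t eq x → resp (strictlyInverseʳ x) (h⇒ s t eq (to x))
    where open Inverse I↔

-- Letters of `τ` as steps in the kernel category.

module KernelPaths (A : Setoid 0ℓ 0ℓ) (finA : Finite A) (M N : Monoid 0ℓ 0ℓ)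
                   (N∈𝐉 : N ∈ 𝐉) (φ : Hom (A *) M) (ψ : Hom (A *) N) where
  private
    module A = Setoid A
    module M = Monoid M
    module N = Monoid N
    module φ = MonoidHomomorphism φ
    module ψ = MonoidHomomorphism ψ

    Step : Setoid 0ℓ 0ℓ
    Step = ContextAlphabet A N

    Object : Setoid 0ℓ 0ℓ
    Object = N.setoid ×ₛ N.setoid

    module Step = Setoid Step
    module O = Setoid Object
    open Membership Step using () renaming (_∈_ to _∈ₗ_)

  finObject : Finite Object
  finObject = ×-finite (proj₁ N∈𝐉) (proj₁ N∈𝐉)

  finStep : Finite Step
  finStep = ×-finite (proj₁ N∈𝐉) (×-finite finA (proj₁ N∈𝐉))

  _≟ₒ_ : Decidable O._≈_
  _≟ₒ_ = finite⇒decidable finObject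

  letter : Step.Carrier → A.Carrier
  letter (_ , a , _) = a

  word : List Step.Carrier → List A.Carrier
  word = map letter

  -- The first coordinate of an object is the value of the text already read, the second that of the
  -- text to come. Reading `a` moves `ψ.⟦ [ a ] ⟧` from the second to the first.
  source target : Step.Carrier → O.Carrier
  source (n₁ , a , n₂) = n₁ , ψ.⟦ [ a ] ⟧ N.∙ n₂
  target (n₁ , a , n₂) = n₁ N.∙ ψ.⟦ [ a ] ⟧ , n₂

  ψ-letter-cong : ∀ {a b} → a A.≈ b → ψ.⟦ [ a ] ⟧ N.≈ ψ.⟦ [ b ] ⟧
  ψ-letter-cong a≈b = ψ.⟦⟧-cong (a≈b ∷ [])
    where open ListEquality A

  source-cong : ∀ {σ ρ} → σ Step.≈ ρ → source σ O.≈ source ρ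
  source-cong (p , q , r) = p , N.∙-cong (ψ-letter-cong q) r

  target-cong : ∀ {σ ρ} → σ Step.≈ ρ → target σ O.≈ target ρ
  target-cong (p , q , r) = N.∙-cong p (ψ-letter-cong q) , r

  -- Reachability as a partial order on objects.

  _≼_ : O.Carrier → O.Carrier → Set
  (x₁ , x₂) ≼ (y₁ , y₂) = ∃ λ n → x₁ N.∙ n N.≈ y₁ × x₂ N.≈ n N.∙ y₂

  ≼-reflexive : ∀ {x y} → x O.≈ y → x ≼ y
  ≼-reflexive (p , q) =
    N.ε , N.trans (N.identityʳ _) p , N.trans q (N.sym (N.identityˡ _))

  ≼-trans : ∀ {x y z} → x ≼ y → y ≼ z → x ≼ z
  ≼-trans (m , p , q) (n , p′ , q′) =
    m N.∙ n ,
    N.trans (N.sym (N.assoc _ _ _)) (N.trans (N.∙-congʳ p) p′) ,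
    N.trans q (N.trans (N.∙-congˡ q′) (N.sym (N.assoc _ _ _)))

  ideal-⊆ : ∀ {s t c d} → s N.≈ c N.∙ t N.∙ d → TwoSidedIdeal N s ⊆ TwoSidedIdeal N t
  ideal-⊆ {s} {t} {c} {d} s≈ctd {x} (a , b , x≈asb) = a N.∙ c , d N.∙ b , (begin
    x                                ≈⟨ x≈asb ⟩
    a N.∙ s N.∙ b                    ≈⟨ N.∙-congʳ (N.∙-congˡ s≈ctd) ⟩
    a N.∙ (c N.∙ t N.∙ d) N.∙ b      ≈⟨ N.∙-congʳ (N.assoc _ _ _) ⟨
    a N.∙ (c N.∙ t) N.∙ d N.∙ b      ≈⟨ N.∙-congʳ (N.∙-congʳ (N.assoc _ _ _)) ⟨
    a N.∙ c N.∙ t N.∙ d N.∙ b        ≈⟨ N.assoc _ _ _ ⟩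
    a N.∙ c N.∙ t N.∙ (d N.∙ b)      ∎)
    where open SetoidReasoning N.setoid

  ideal-⊆ʳ : ∀ {s t d} → t N.∙ d N.≈ s → TwoSidedIdeal N s ⊆ TwoSidedIdeal N t
  ideal-⊆ʳ p = ideal-⊆ (N.trans (N.sym p) (N.∙-congʳ (N.sym (N.identityˡ _))))

  ideal-⊆ˡ : ∀ {s t c} → s N.≈ c N.∙ t → TwoSidedIdeal N s ⊆ TwoSidedIdeal N t
  ideal-⊆ˡ p = ideal-⊆ (N.trans p (N.sym (N.identityʳ _)))

  -- Here J-triviality enters: the first coordinates are right multiples of each other and the
  -- second ones left multiples, so each pair generates one two-sided ideal. The multipliers may be
  -- any elements of `N`, not only values of `ψ`.
  ≼-antisym : ∀ {x y} → x ≼ y → y ≼ x → x O.≈ y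
  ≼-antisym (m , p , q) (n , p′ , q′) =
    proj₂ N∈𝐉 _ _ (ideal-⊆ʳ p′ , ideal-⊆ʳ p) ,
    proj₂ N∈𝐉 _ _ (ideal-⊆ˡ q , ideal-⊆ˡ q′)

  source≼target : ∀ σ → source σ ≼ target σ
  source≼target (_ , a , _) = ψ.⟦ [ a ] ⟧ , N.refl , N.refl

  -- Paths and their decomposition.

  data Path : O.Carrier → List Step.Carrier → O.Carrier → Set where
    stop : ∀ {x y} → x O.≈ y → Path x [] y
    step : ∀ {x y σ s} → x O.≈ source σ → Path (target σ) s y → Path x (σ ∷ s) y

  Path-resp : ∀ {x x′ y y′ s} → x O.≈ x′ → y O.≈ y′ → Path x s y → Path x′ s y′
  Path-resp p q (stop r)    = stop (O.trans (O.sym p) (O.trans r q))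
  Path-resp p q (step r π)  = step (O.trans (O.sym p) r) (Path-resp O.refl q π)

  Path⇒≼ : ∀ {x s y} → Path x s y → x ≼ y
  Path⇒≼ (stop p)           = ≼-reflexive p
  Path⇒≼ (step {σ = σ} p π) =
    ≼-trans (≼-reflexive p) (≼-trans (source≼target σ) (Path⇒≼ π))

  start≼source : ∀ {x s y} → Path x s y → All (λ σ → x ≼ source σ) s
  start≼source (stop _)           = []
  start≼source (step {σ = σ} p π) =
    ≼-reflexive p ∷
    All.map (≼-trans (≼-trans (≼-reflexive p) (source≼target σ))) (start≼source π)

  -- The occurrence found in `t` is only setoid-equal to `σ`, so the actual letter `ρ` of `t` is
  -- returned with it.
  Path-split : ∀ {x t y σ} → Path x t y → σ ∈ₗ t →
    ∃ λ t₀ → ∃ λ ρ → ∃ λ t₁ →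
      t ≡ t₀ ++ ρ ∷ t₁ × σ Step.≈ ρ × Path x t₀ (source ρ) × Path (target ρ) t₁ y
  Path-split (step p π) (here σ≈ρ)   = [] , _ , _ , ≡.refl , σ≈ρ , stop p , π
  Path-split (step p π) (there σ∈t) =
    let t₀ , ρ , t₁ , eq , σ≈ρ , π₀ , π₁ = Path-split π σ∈t in
    _ ∷ t₀ , ρ , t₁ , ≡.cong (_ ∷_) eq , σ≈ρ , step p π₀ , π₁

  -- Loops, transitions and the words read at one object.

  Transition : Pred Step.Carrier 0ℓ
  Transition σ = ¬ source σ O.≈ target σ

  Loop : O.Carrier → Pred Step.Carrier 0ℓ
  Loop x σ = source σ O.≈ x × target σ O.≈ x

  loop? : ∀ x σ → Dec (Loop x σ)
  loop? x σ = (source σ ≟ₒ x) ×-dec (target σ ≟ₒ x)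

  Loop-cong : ∀ {x y σ} → x O.≈ y → Loop x σ → Loop y σ
  Loop-cong x≈y (p , q) = O.trans p x≈y , O.trans q x≈y

  Loop-resp : ∀ {x σ ρ} → σ Step.≈ ρ → Loop x σ → Loop x ρ
  Loop-resp σ≈ρ (p , q) =
    O.trans (O.sym (source-cong σ≈ρ)) p , O.trans (O.sym (target-cong σ≈ρ)) q

  -- The first target lies above `x` and below the end of the path, which is `x` again, so
  -- antisymmetry keeps it at `x`.
  closed-path-loops : ∀ {x s y} → Path x s y → x O.≈ y → All (Loop x) s
  closed-path-loops (stop _) _ = []
  closed-path-loops {x} (step {σ = σ} p π) x≈y =
    (O.sym p , target≈x) ∷
    All.map (Loop-cong target≈x) (closed-path-loops π (O.trans target≈x x≈y))
    where
    target≈x : target σ O.≈ x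
    target≈x = ≼-antisym
      (≼-trans (Path⇒≼ π) (≼-reflexive (O.sym x≈y)))
      (≼-trans (≼-reflexive p) (source≼target σ))

  -- Every later source lies above `target σ`. Were it `source σ`, antisymmetry would turn the
  -- transition into a loop.
  no-return : ∀ {σ s y} → Transition σ → Path (target σ) s y →
              All (λ ρ → ¬ source ρ O.≈ source σ) s
  no-return {σ} σ≉ π = All.map
    (λ target≼ eq → σ≉ (≼-antisym (source≼target σ) (≼-trans target≼ (≼-reflexive eq))))
    (start≼source π)

  -- On a path the selected steps are consecutive, because the path cannot come back to `x`; the
  -- word is then the label of its stay at `x`. Filtering is multiplicative on arbitrary lists,
  -- which yields a homomorphism.
  loopWord : O.Carrier → List Step.Carrier → List A.Carrier
  loopWord x s = word (filter (loop? x) s)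

  loopWord-++ : ∀ x s t → loopWord x (s ++ t) ≡ loopWord x s ++ loopWord x t
  loopWord-++ x s t =
    ≡.trans (≡.cong word (filter-++ (loop? x) s t)) (map-++ letter (filter (loop? x) s) _)

  loopWord-cong : ∀ {x y} → x O.≈ y → ∀ s → loopWord x s ≡ loopWord y s
  loopWord-cong {x} {y} x≈y s = ≡.cong word
    (filter-≐ (loop? x) (loop? y) (Loop-cong x≈y , Loop-cong (O.sym x≈y)) s)

  loopWord-resp : ∀ x {s t} → ListEquality._≋_ Step s t →
                  ListEquality._≋_ A (loopWord x s) (loopWord x t)
  loopWord-resp x s≋t = ListEquality.map⁺ Step A (λ (_ , a≈b , _) → a≈b)
    (ListEquality.filter⁺ Step (loop? x) Loop-resp s≋t)

  loopWord-all : ∀ {x s} → All (Loop x) s → loopWord x s ≡ word s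
  loopWord-all loops = ≡.cong word (filter-all (loop? _) loops)

  loopWord-none : ∀ {x s} → All (λ σ → ¬ source σ O.≈ x) s → loopWord x s ≡ []
  loopWord-none none = ≡.cong word (filter-none (loop? _) (All.map (λ ¬p (p , _) → ¬p p) none))

  loopWord-transition : ∀ x {σ} s → Transition σ → loopWord x (σ ∷ s) ≡ loopWord x s
  loopWord-transition x s σ≉ = ≡.cong word
    (filter-reject (loop? x) (λ (p , q) → σ≉ (O.trans p (O.sym q))))

  -- Each label of a loop at `x` fixes the first coordinate from the right. With the dual fact
  -- `loops-right`, this makes the word an arrow from `x` to `x`.
  loops-left : ∀ {x s} → All (Loop x) s → proj₁ x N.≈ proj₁ x N.∙ ψ.⟦ word s ⟧
  loops-left [] = N.sym (N.trans (N.∙-congˡ ψ.ε-homo) (N.identityʳ _))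
  loops-left {x₁ , x₂} {(n₁ , a , n₂) ∷ s} (((p , _) , (q , _)) ∷ loops) = begin
    x₁                                        ≈⟨ loops-left loops ⟩
    x₁ N.∙ ψ.⟦ word s ⟧                       ≈⟨ N.∙-congʳ q ⟨
    n₁ N.∙ ψ.⟦ [ a ] ⟧ N.∙ ψ.⟦ word s ⟧       ≈⟨ N.∙-congʳ (N.∙-congʳ p) ⟩
    x₁ N.∙ ψ.⟦ [ a ] ⟧ N.∙ ψ.⟦ word s ⟧       ≈⟨ N.assoc _ _ _ ⟩
    x₁ N.∙ (ψ.⟦ [ a ] ⟧ N.∙ ψ.⟦ word s ⟧)     ≈⟨ N.∙-congˡ (ψ.homo [ a ] (word s)) ⟨
    x₁ N.∙ ψ.⟦ a ∷ word s ⟧                   ∎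
    where open SetoidReasoning N.setoid

  loops-right : ∀ {x s} → All (Loop x) s → ψ.⟦ word s ⟧ N.∙ proj₂ x N.≈ proj₂ x
  loops-right [] = N.trans (N.∙-congʳ ψ.ε-homo) (N.identityˡ _)
  loops-right {x₁ , x₂} {(n₁ , a , n₂) ∷ s} (((_ , p) , (_ , q)) ∷ loops) = begin
    ψ.⟦ a ∷ word s ⟧ N.∙ x₂                   ≈⟨ N.∙-congʳ (ψ.homo [ a ] (word s)) ⟩
    ψ.⟦ [ a ] ⟧ N.∙ ψ.⟦ word s ⟧ N.∙ x₂       ≈⟨ N.assoc _ _ _ ⟩
    ψ.⟦ [ a ] ⟧ N.∙ (ψ.⟦ word s ⟧ N.∙ x₂)     ≈⟨ N.∙-congˡ (loops-right loops) ⟩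
    ψ.⟦ [ a ] ⟧ N.∙ x₂                        ≈⟨ N.∙-congˡ q ⟨
    ψ.⟦ [ a ] ⟧ N.∙ n₂                        ≈⟨ p ⟩
    x₂                                        ∎
    where open SetoidReasoning N.setoid

  -- Equality of arrows and the products of loops.

  φ-≡ : ∀ {u v} → u ≡ v → φ.⟦ u ⟧ M.≈ φ.⟦ v ⟧
  φ-≡ ≡.refl = M.refl

  -- This is `SameArrow` on bare words, free of the proofs that the words represent arrows.
  Interchangeable : O.Carrier → O.Carrier → List A.Carrier → List A.Carrier → Set
  Interchangeable (x₁ , _) (_ , y₂) u u′ =
    ∀ v w → ψ.⟦ v ⟧ N.≈ x₁ → ψ.⟦ w ⟧ N.≈ y₂ → φ.⟦ v ++ u ++ w ⟧ M.≈ φ.⟦ v ++ u′ ++ w ⟧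

  loopProduct : ∀ x → Hom (Step *) (Category.baseMonoid (ker A M N φ ψ) x)
  loopProduct x = record
    { ⟦_⟧ = λ s → arrow (loopWord x s)
        (loops-left (all-filter (loop? x) s)) (loops-right (all-filter (loop? x) s))
    ; isMonoidHomomorphism = record
      { isMagmaHomomorphism = record
        { isRelHomomorphism = record
          { cong = λ s≋t v w _ _ → φ.⟦⟧-cong
              (++⁺ (≋-refl {v}) (++⁺ (loopWord-resp x s≋t) (≋-refl {w})))
          }
        ; homo = λ s t v w _ _ → φ-≡ (≡.cong (λ u → v ++ u ++ w) (loopWord-++ x s t))
        }
      ; ε-homo = λ _ _ _ _ → M.refl
      }
    }
    where open ListEquality A

  LoopAgree : O.Carrier → List Step.Carrier → List Step.Carrier → Set
  LoopAgree x s t = Interchangeable x x (loopWord x s) (loopWord x t)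

  LoopAgree-resp : ∀ {x y s t} → x O.≈ y → LoopAgree x s t → LoopAgree y s t
  LoopAgree-resp {x} {y} {s} {t} x≈y@(p , q) agree
    rewrite ≡.sym (loopWord-cong x≈y s) | ≡.sym (loopWord-cong x≈y t) =
    λ v w ψv ψw → agree v w (N.trans ψv (N.sym p)) (N.trans ψw (N.sym q))

  -- Comparison of paths with common endpoints.

  path-word : ∀ {x s y} → Path x s y → ∀ v → ψ.⟦ v ⟧ N.≈ proj₁ x →
              ψ.⟦ v ++ word s ⟧ N.≈ proj₁ y
  path-word (stop (p , _)) v ψv =
    N.trans (ψ.homo v [])
      (N.trans (N.∙-congˡ ψ.ε-homo) (N.trans (N.identityʳ _) (N.trans ψv p)))
  path-word (step {σ = _ , a , _} {s = s} (p , _) π) v ψv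
    rewrite ≡.sym (∷ʳ-++ v a (word s)) =
    path-word π (v ∷ʳ a) (N.trans (ψ.homo v [ a ]) (N.∙-congʳ (N.trans ψv p)))

  -- This and `path-word` give the values of contexts enlarged by a path, as `Interchangeable`
  -- demands when part of a word is replaced.
  word-path : ∀ {x s y} → Path x s y → ∀ w → ψ.⟦ w ⟧ N.≈ proj₂ y →
              ψ.⟦ word s ++ w ⟧ N.≈ proj₂ x
  word-path (stop (_ , p)) w ψw = N.trans ψw (N.sym p)
  word-path (step {σ = _ , a , _} (_ , p) π) w ψw =
    N.trans (ψ.homo [ a ] _) (N.trans (N.∙-congˡ (word-path π w ψw)) (N.sym p))

  -- Recursion on s; s₀ collects the loops already read at the current object x.
  -- If s continues with a transition, t must contain it too, and everything that
  -- precedes it in t is a loop at x.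
  paths-agree : ∀ {x y} s₀ s t → All (Loop x) s₀ → Path x s y → Path x t y →
    (∀ σ → Transition σ → σ ∈ₗ s → σ ∈ₗ t) →
    (∀ z → LoopAgree z (s₀ ++ s) t) →
    Interchangeable x y (word (s₀ ++ s)) (word t)
  -- Now `x` and `y` coincide, so `t` is a closed path and consists of loops at `x`; agreement at
  -- `x` compares the two words entirely.
  paths-agree {x} s₀ [] t loops (stop x≈y@(_ , x₂≈y₂)) π′ _ agree v w ψv ψw =
    ≡.subst₂ (λ p q → φ.⟦ v ++ p ++ w ⟧ M.≈ φ.⟦ v ++ q ++ w ⟧)
      (loopWord-all (≡.subst (All _) (≡.sym (++-identityʳ s₀)) loops))
      (loopWord-all (closed-path-loops π′ x≈y))
      (agree x v w ψv (N.trans ψw (N.sym x₂≈y₂)))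
  paths-agree {x} {y} s₀ (σ ∷ s) t loops (step x≈source π) π′ trans⊆ agree
    with source σ ≟ₒ target σ
  ... | yes source≈target =
    ≡.subst (λ r → Interchangeable x y (word r) (word t)) (∷ʳ-++ s₀ σ s)
      (paths-agree (s₀ ∷ʳ σ) s t
        (∷ʳ⁺ loops (O.sym x≈source , target≈x))
        (Path-resp target≈x O.refl π) π′
        (λ ρ ρ≉ ρ∈s → trans⊆ ρ ρ≉ (there ρ∈s))
        (λ z → ≡.subst (λ r → LoopAgree z r t) (≡.sym (∷ʳ-++ s₀ σ s)) (agree z)))
    where
    target≈x : target σ O.≈ x
    target≈x = O.trans (O.sym source≈target) (O.sym x≈source)
  ... | no σ≉ with Path-split π′ (trans⊆ σ σ≉ (here Step.refl))
  ... | t₀ , ρ , t₁ , ≡.refl , σ≈ρ@(_ , a≈b , _) , π₀ , π₁ = λ v w ψv ψw → begin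
    -- Three replacements follow: the loops before the transition, the label of the transition, and
    -- what comes after it. The unreplaced parts join the contexts.
    φ.⟦ v ++ word (s₀ ++ σ ∷ s) ++ w ⟧
      ≈⟨ φ-≡ (≡.cong (v ++_) (reassoc s₀ σ s w)) ⟩
    φ.⟦ v ++ word s₀ ++ letter σ ∷ word s ++ w ⟧
      ≈⟨ prefixes v (letter σ ∷ word s ++ w) ψv
           (word-path (step {σ = σ} x≈source π) w ψw) ⟩
    φ.⟦ v ++ word t₀ ++ letter σ ∷ word s ++ w ⟧
      ≈⟨ φ.⟦⟧-cong (++⁺ (≋-refl {v}) (++⁺ (≋-refl {word t₀}) (a≈b ∷ ≋-refl))) ⟩
    φ.⟦ v ++ word t₀ ++ letter ρ ∷ word s ++ w ⟧
      ≈⟨ φ-≡ (regroup v (word t₀) (letter ρ) (word s ++ w)) ⟩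
    φ.⟦ ((v ++ word t₀) ∷ʳ letter ρ) ++ word s ++ w ⟧
      ≈⟨ suffixes _ w
           (N.trans (ψ.homo (v ++ word t₀) [ letter ρ ])
             (N.∙-congʳ (path-word π₀ v ψv))) ψw ⟩
    φ.⟦ ((v ++ word t₀) ∷ʳ letter ρ) ++ word t₁ ++ w ⟧
      ≈⟨ φ-≡ (regroup v (word t₀) (letter ρ) (word t₁ ++ w)) ⟨
    φ.⟦ v ++ word t₀ ++ letter ρ ∷ word t₁ ++ w ⟧
      ≈⟨ φ-≡ (≡.cong (v ++_) (reassoc t₀ ρ t₁ w)) ⟨
    φ.⟦ v ++ word (t₀ ++ ρ ∷ t₁) ++ w ⟧ ∎
    where
    open SetoidReasoning M.setoid
    open ListEquality A

    reassoc : ∀ r τ r′ w → word (r ++ τ ∷ r′) ++ w ≡ word r ++ letter τ ∷ word r′ ++ w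
    reassoc r τ r′ w =
      ≡.trans (≡.cong (_++ w) (map-++ letter r (τ ∷ r′))) (++-assoc (word r) _ w)

    regroup : ∀ v u a (w : List A.Carrier) → v ++ u ++ a ∷ w ≡ ((v ++ u) ∷ʳ a) ++ w
    regroup v u a w = ≡.trans (≡.sym (++-assoc v u (a ∷ w))) (≡.sym (∷ʳ-++ (v ++ u) a w))

    x≈sourceρ : x O.≈ source ρ
    x≈sourceρ = O.trans x≈source (source-cong {σ} {ρ} σ≈ρ)

    ρ≉ : Transition ρ
    ρ≉ eq = σ≉ (O.trans (source-cong {σ} {ρ} σ≈ρ)
                 (O.trans eq (O.sym (target-cong {σ} {ρ} σ≈ρ))))

    loops₀ : All (Loop x) t₀
    loops₀ = closed-path-loops π₀ x≈sourceρ

    after : ∀ {z} τ r′ → z O.≈ source τ → Transition τ → Path (target τ) r′ y →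
            loopWord z r′ ≡ []
    after τ r′ z≈ τ≉ πᵣ = loopWord-none
      (All.map (λ ¬eq eq → ¬eq (O.trans eq z≈)) (no-return τ≉ πᵣ))

    -- The prefix consists of loops at `x`, the transition is no loop, and the path never revisits
    -- `x`; only the prefix survives the filter.
    at-x : ∀ r τ r′ → Transition τ → x O.≈ source τ → All (Loop x) r →
           Path (target τ) r′ y → loopWord x (r ++ τ ∷ r′) ≡ word r
    at-x r τ r′ τ≉ x≈ loopsᵣ πᵣ = ≡.trans (loopWord-++ x r (τ ∷ r′))
      (≡.trans (≡.cong₂ _++_ (loopWord-all loopsᵣ)
        (≡.trans (loopWord-transition x r′ τ≉) (after τ r′ x≈ τ≉ πᵣ)))
        (++-identityʳ (word r)))

    off-x : ∀ {z} r τ r′ → ¬ z O.≈ x → Transition τ → All (Loop x) r →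
            loopWord z (r ++ τ ∷ r′) ≡ loopWord z r′
    off-x {z} r τ r′ z≉x τ≉ loopsᵣ = ≡.trans (loopWord-++ z r (τ ∷ r′))
      (≡.cong₂ _++_
        (loopWord-none (All.map (λ (p , _) eq → z≉x (O.trans (O.sym eq) p)) loopsᵣ))
        (loopWord-transition z r′ τ≉))

    prefixes : Interchangeable x x (word s₀) (word t₀)
    prefixes = ≡.subst₂ (Interchangeable x x)
      (at-x s₀ σ s σ≉ x≈source loops π)
      (at-x t₀ ρ t₁ ρ≉ x≈sourceρ loops₀ π₁)
      (agree x)

    -- In `t` the letter can lie neither in `t₀`, which has only loops, nor at `ρ`, since by
    -- `no-return` no step of `s` starts at `source σ`.
    transitions : ∀ τ → Transition τ → τ ∈ₗ s → τ ∈ₗ t₁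
    transitions τ τ≉ τ∈s with ++⁻ t₀ (trans⊆ τ τ≉ (there τ∈s))
    ... | inj₁ τ∈t₀ =
      let p , q = All.lookupₛ Step Loop-resp loops₀ τ∈t₀ in
      contradiction (O.trans p (O.sym q)) τ≉
    ... | inj₂ (here τ≈ρ) = contradiction
      (source-cong {τ} {σ} (Step.trans τ≈ρ (Step.sym σ≈ρ)))
      (All.lookupₛ Step
        (λ {κ} {κ′} κ≈κ′ ¬eq eq → ¬eq (O.trans (source-cong {κ} {κ′} κ≈κ′) eq))
        (no-return σ≉ π) τ∈s)
    ... | inj₂ (there τ∈t₁) = τ∈t₁

    -- At `x` no loop remains on either side; at any other object the removed prefixes and
    -- transitions contributed nothing.
    agree′ : ∀ z → LoopAgree z s t₁
    agree′ z with z ≟ₒ x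
    ... | yes z≈x = ≡.subst₂ (Interchangeable z z)
      (≡.sym (after σ s (O.trans z≈x x≈source) σ≉ π))
      (≡.sym (after ρ t₁ (O.trans z≈x x≈sourceρ) ρ≉ π₁))
      (λ _ _ _ _ → M.refl)
    ... | no z≉x = ≡.subst₂ (Interchangeable z z)
      (off-x s₀ σ s z≉x σ≉ loops)
      (off-x t₀ ρ t₁ z≉x ρ≉ loops₀)
      (agree z)

    suffixes : Interchangeable (target ρ) y (word s) (word t₁)
    -- At the new object the collection of loops starts empty.
    suffixes = paths-agree [] s t₁ []
      (Path-resp (target-cong {σ} {ρ} σ≈ρ) O.refl π) π₁ transitions agree′

  -- The path traced by `τ`.

  private
    τᵖ : List A.Carrier → List A.Carrier → List Step.Carrier
    τᵖ = τ-after A N ψ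

  τ-after-word : ∀ u v → word (τᵖ u v) ≡ v
  τ-after-word u []      = ≡.refl
  τ-after-word u (a ∷ v) = ≡.cong (a ∷_) (τ-after-word (u ∷ʳ a) v)

  -- With `u` read and `v` to come, the current object is the pair of their values; at the end
  -- nothing is to come, whence `N.ε`.
  τ-after-path : ∀ u v → Path (ψ.⟦ u ⟧ , ψ.⟦ v ⟧) (τᵖ u v) (ψ.⟦ u ++ v ⟧ , N.ε)
  τ-after-path u [] = stop (ψ.⟦⟧-cong (≋-reflexive (≡.sym (++-identityʳ u))) , ψ.ε-homo)
    where open ListEquality A
  τ-after-path u (a ∷ v) = step (N.refl , ψ.homo [ a ] v)
    (Path-resp (ψ.homo u [ a ] , N.refl)
               (ψ.⟦⟧-cong (≋-reflexive (∷ʳ-++ u a v)) , N.refl)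
               (τ-after-path (u ∷ʳ a) v))
    where open ListEquality A

  τ-determines-φ : ∀ v w → ψ.⟦ v ⟧ N.≈ ψ.⟦ w ⟧ →
    (∀ σ → σ ∈ₗ τ A N ψ v → σ ∈ₗ τ A N ψ w) →
    (∀ z → LoopAgree z (τ A N ψ v) (τ A N ψ w)) →
    φ.⟦ v ⟧ M.≈ φ.⟦ w ⟧
  τ-determines-φ v w ψv≈ψw letters⊆ agree = begin
    φ.⟦ v ⟧                      ≈⟨ φ-≡ (++-identityʳ v) ⟨
    φ.⟦ v ++ [] ⟧                ≡⟨ ≡.cong (λ u → φ.⟦ u ++ [] ⟧) (τ-after-word [] v) ⟨
    φ.⟦ word (τᵖ [] v) ++ [] ⟧   ≈⟨ same [] [] N.refl ψ.ε-homo ⟩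
    φ.⟦ word (τᵖ [] w) ++ [] ⟧   ≡⟨ ≡.cong (λ u → φ.⟦ u ++ [] ⟧) (τ-after-word [] w) ⟩
    φ.⟦ w ++ [] ⟧                ≈⟨ φ-≡ (++-identityʳ w) ⟩
    φ.⟦ w ⟧                      ∎
    where
    open SetoidReasoning M.setoid

    same : Interchangeable (ψ.⟦ [] ⟧ , ψ.⟦ v ⟧) (ψ.⟦ v ⟧ , N.ε)
                           (word (τᵖ [] v)) (word (τᵖ [] w))
    same = paths-agree [] (τᵖ [] v) (τᵖ [] w) []
      (τ-after-path [] v)
      -- Equality of the values under `ψ` gives both paths the same start and the same end.
      (Path-resp (N.refl , N.sym ψv≈ψw) (N.sym ψv≈ψw , N.refl) (τ-after-path [] w))
      (λ σ _ → letters⊆ σ) agree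

-- Assembly of the recognizing homomorphism.

theorem3p1 : ∀ {p : Level} (A : Setoid 0ℓ 0ℓ) → Finite A →
    (M N : Monoid 0ℓ 0ℓ) → FiniteMonoid M → N ∈ 𝐉 →
    (φ : Hom (A *) M) → Onto (A *) M φ →
    (ψ : Hom (A *) N) →
    (V : Pred (Monoid 0ℓ 0ℓ) p) → IsPseudovariety V → 𝐉₁ ⊆ V →
    (∀ x → Category.baseMonoid (ker A M N φ ψ) x ∈ V) →
    M ∈ (V ** 𝐉)
theorem3p1 A finA M N finM N∈𝐉 φ onto ψ V pv 𝐉₁⊆V base∈V =
  let K , K∈V , h , h⇒ = letters ∧ᵈ loops in
  finM , A , finA , φ , onto , N , N∈𝐉 , ψ , K , K∈V , h , λ v w ψv≈ψw eq →
    let letters⊆ , agree = h⇒ (τ A N ψ v) (τ A N ψ w) eq in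
    τ-determines-φ v w ψv≈ψw letters⊆ agree
  where
  Step : Setoid 0ℓ 0ℓ
  Step = ContextAlphabet A N

  open KernelPaths A finA M N N∈𝐉 φ ψ
  open Recognition V pv Step
  open Containment Step (finite⇒decidable finStep)
  open Membership Step using () renaming (_∈_ to _∈ₗ_)

  letters : Determines (λ s t → ∀ σ → σ ∈ₗ s → σ ∈ₗ t)
  letters = ⋀ finStep
    (λ σ≈ρ σ⊆ ρ∈s → ∈-resp-≈ Step σ≈ρ (σ⊆ (∈-resp-≈ Step (Setoid.sym Step σ≈ρ) ρ∈s)))
    -- One semilattice factor per letter records the set of letters.
    (λ σ → ∨-monoid , 𝐉₁⊆V {∨-monoid} ∨-∈-𝐉₁ , contains σ , contains-≡⇒⊆ σ)

  loops : Determines (λ s t → ∀ x → LoopAgree x s t)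
  loops = ⋀ finObject (λ {x} {y} {s} {t} → LoopAgree-resp {x} {y} {s} {t})
    -- Equality in the base monoid at `x` unfolds to `LoopAgree x`, so the implication is the
    -- identity.
    (λ x → _ , base∈V x , loopProduct x , λ _ _ eq → eq)
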